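{- Let $p$ be an odd prime, let $\alpha,\beta$ be positive integers, and let $G = \mathbb{Z}_{p^{\alpha}}\oplus\mathbb{Z}_{p^\beta}$, with exponent $\exp(G)=p^{\max(\alpha,\beta)}$. Let $A=\{a\in\mathbb{N} : 1\le a\le p^{\max(\alpha,\beta)},\ \gcd(a,p)=1\}$. Then $s_{A}(G)= \eta_A(G) + \exp(G) - 1$.
   Context: $\mathbb{Z}_n$ denotes the cyclic group $\mathbb{Z}/n\mathbb{Z}$. A sequence over a finite abelian group $G$ (written additively) is a finite list of elements of $G$, repetitions allowed, order irrelevant; its length is its number of terms, and a subsequence is obtained by choosing a subset of the indices. For a set of integers $A$, a sequence $x_1\cdots x_k$ over $G$ ($k\ge 1$) is an $A$-weighted zero-sum sequence of length $k$ if there exist $u_1,\dots,u_k\in A$ (not necessarily distinct) with $u_1x_1+\cdots+u_kx_k=0$ in $G$. If $G$ has exponent $n$: $s_A(G)$ is the smallest integer $\ell$ such that every sequence over $G$ of length at least $\ell$ has an $A$-weighted zero-sum subsequence of length exactly $n$; $\eta_A(G)$ is the smallest integer $\ell$ such that every sequence over $G$ of length at least $\ell$ has a nonempty $A$-weighted zero-sum subsequence of length at most $n$. -}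

module Defs where

open import Algebra.Bundles using (AbelianGroup)
open import Algebra.Construct.DirectProduct using (abelianGroup)
import Algebra.Definitions.RawMonoid as RawMonoidDefinitions
open import Data.Integer.Base as ℤ using (ℤ; +_; -[1+_])
open import Data.Integer.Divisibility.Signed as ℤ
  using (_∣_; divides; ∣m⇒∣-m; ∣m∣n⇒∣m+n)
import Data.Integer.Properties as ℤ
open import Data.Integer.Tactic.RingSolver using (solve-∀)
open import Data.List.Base using (List; foldr; length; zipWith)
open import Data.List.Relation.Binary.Sublist.Propositional using (_⊆_)
open import Data.List.Relation.Unary.All using (All)
open import Data.Nat.Base using (ℕ; suc; _≤_)
open import Data.Nat.GCD using (gcd)
open import Data.Product.Base using (_×_; _,_; ∃-syntax)
open import Level using (Level; 0ℓ)
open import Relation.Binary.PropositionalEquality using (_≡_; refl; subst)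
open import Relation.Unary using (Pred)

private
  variable
    a ℓ r : Level

IsLeast : Pred ℕ r → ℕ → Set r
IsLeast P m = P m × (∀ k → P k → m ≤ k)

-- A sequence over G is a list of elements. All notions below are invariant
-- under reordering, so lists need not be quotiented by permutation; choosing a
-- subset of the indices is the same as choosing a sublist.
module _ (G : AbelianGroup a ℓ) where
  open AbelianGroup G renaming (_∙_ to _+_; ε to 0#; _⁻¹ to -_)
  open RawMonoidDefinitions rawMonoid using () renaming (_×_ to _·ℕ_)

  infixr 8 _·_

  _·_ : ℤ → Carrier → Carrier
  (+ n)    · x = n ·ℕ x
  -[1+ n ] · x = - (suc n ·ℕ x)

  IsExponent : ℕ → Set _
  IsExponent = IsLeast λ n → 1 ≤ n × (∀ x → n ·ℕ x ≈ 0#)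

  IsWeightedZeroSum : Pred ℤ r → List Carrier → Set _
  IsWeightedZeroSum A xs =
    1 ≤ length xs ×
    ∃[ us ] length us ≡ length xs × All A us × foldr _+_ 0# (zipWith _·_ us xs) ≈ 0#

  -- Is-s A m says that s_A(G) exists and equals m. The least element is sought
  -- in ℕ rather than in ℤ: because of the empty sequence, no m ≤ 0 has the
  -- required property. The same goes for Is-η.
  Is-s : Pred ℤ r → ℕ → Set _
  Is-s A m = ∃[ n ] IsExponent n × IsLeast
    (λ k → ∀ (xs : List Carrier) → k ≤ length xs →
      ∃[ ys ] ys ⊆ xs × length ys ≡ n × IsWeightedZeroSum A ys) m

  Is-η : Pred ℤ r → ℕ → Set _
  Is-η A m = ∃[ n ] IsExponent n × IsLeast
    (λ k → ∀ (xs : List Carrier) → k ≤ length xs →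
      ∃[ ys ] ys ⊆ xs × length ys ≤ n × IsWeightedZeroSum A ys) m

-- The quotient ℤ/nℤ is the setoid of integers modulo n, so group elements are
-- given by arbitrary integer representatives.
ℤmod : ℕ → AbelianGroup 0ℓ 0ℓ
ℤmod n = record
  { Carrier = ℤ
  ; _≈_     = _≈_
  ; _∙_     = ℤ._+_
  ; ε       = ℤ.0ℤ
  ; _⁻¹     = ℤ.-_
  ; isAbelianGroup = record
    { isGroup = record
      { isMonoid = record
        { isSemigroup = record
          { isMagma = record
            { isEquivalence = record
              { refl  = λ {x} → reflexive {x} refl
              ; sym   = λ {x} {y} p → subst (+ n ∣_) (neg-sub x y) (∣m⇒∣-m p)
              ; trans = λ {x} {y} {z} p q →
                  subst (+ n ∣_) (telescope x y z) (∣m∣n⇒∣m+n p q)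
              }
            ; ∙-cong = λ {x} {y} {u} {v} p q →
                subst (+ n ∣_) (add-sub x y u v) (∣m∣n⇒∣m+n p q)
            }
          ; assoc = λ x y z → reflexive (ℤ.+-assoc x y z)
          }
        ; identity = (λ x → reflexive (ℤ.+-identityˡ x))
                   , (λ x → reflexive (ℤ.+-identityʳ x))
        }
      ; inverse = (λ x → reflexive (ℤ.+-inverseˡ x))
                , (λ x → reflexive (ℤ.+-inverseʳ x))
      ; ⁻¹-cong = λ {x} {y} p → subst (+ n ∣_) (sub-neg x y) (∣m⇒∣-m p)
      }
    ; comm = λ x y → reflexive (ℤ.+-comm x y)
    }
  }
  where
  _≈_ : ℤ → ℤ → Set
  x ≈ y = + n ∣ x ℤ.- y

  reflexive : ∀ {x y} → x ≡ y → x ≈ y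
  reflexive {x} refl = divides ℤ.0ℤ (ℤ.+-inverseʳ x)

  neg-sub : ∀ x y → ℤ.- (x ℤ.- y) ≡ y ℤ.- x
  neg-sub = solve-∀

  telescope : ∀ x y z → (x ℤ.- y) ℤ.+ (y ℤ.- z) ≡ x ℤ.- z
  telescope = solve-∀

  add-sub : ∀ x y u v → (x ℤ.- y) ℤ.+ (u ℤ.- v) ≡ (x ℤ.+ u) ℤ.- (y ℤ.+ v)
  add-sub = solve-∀

  sub-neg : ∀ x y → ℤ.- (x ℤ.- y) ≡ (ℤ.- x) ℤ.- (ℤ.- y)
  sub-neg = solve-∀

infixr 6 _⊕_

_⊕_ : AbelianGroup 0ℓ 0ℓ → AbelianGroup 0ℓ 0ℓ → AbelianGroup 0ℓ 0ℓ
_⊕_ = abelianGroup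

coprimeWeights : (p e : ℕ) → Pred ℤ 0ℓ
coprimeWeights p e u = ∃[ k ] u ≡ + k × 1 ≤ k × k ≤ e × gcd k p ≡ 1

{-# OPTIONS --safe #-}

-- With e = exp(G), both invariants are determined by one bound: every sequence of
-- length e + α + β has a weighted zero-sum subsequence of length e. Appending e − 1
-- zeros to a sequence of length α + β + 1 turns this into the bound for η, and
-- (pⁱ, 0) for i < α together with (0, pʲ) for j < β, with or without e − 1 zeros,
-- shows that neither bound can be lowered: a nonempty sum of these vectors with unit
-- weights has a nonzero coordinate.
--
-- For the bound, let K ⊆ ℤ² be a subgroup containing (pᵃ, 0) and (0, pᵇ), and induct
-- on a + b. If all but one of the vectors lie on a line mod p, drop that one and pass
-- to the sublattice of index p that contains the others. Otherwise there are v, x with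
-- det v x prime to p, and Cramer's rule
--   (det v x) w = (det w x) v + (det v w) x
-- yields a weighted zero-sum as soon as w is a weighted sum of e − 2 other vectors
-- with det w x and det v w prime to p. The weights in w are chosen greedily; this
-- uses a pair of vectors parallel mod p or, in the absence of such a pair, p > 3 or
-- the fact that there are only four directions mod 3.

module Submission where

open import Defs
open import Algebra.Bundles using (AbelianGroup)
open import Data.Empty using (⊥; ⊥-elim)
open import Data.Integer.Base using (ℤ; +_; 0ℤ; 1ℤ; -1ℤ; ∣_∣)
import Data.Integer.DivMod as ℤ
open import Data.Integer.Divisibility.Signed using
  ( divides; ∣ᵤ⇒∣; ∣⇒∣ᵤ; ∣-refl; ∣-trans; *-cancelʳ-∣; ∣m∣n⇒∣m+n; ∣m∣n⇒∣m-n; ∣m⇒∣-m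
  ; ∣m⇒∣m*n; ∣n⇒∣m*n; ∣m+n∣n⇒∣m)
import Data.Integer.Properties as ℤ
open import Data.Integer.Tactic.RingSolver using (solve-∀)
open import Data.List.Base using (List; []; _∷_; _++_; foldr; length; replicate; zipWith)
open import Data.List.Properties using (length-++; length-replicate)
open import Data.List.Relation.Binary.Permutation.Propositional
  using (_↭_; refl; prep; swap; trans; ↭-sym; ↭-trans)
open import Data.List.Relation.Binary.Permutation.Propositional.Properties
  using (All-resp-↭; ↭-length; shift; ++⁺ˡ)
open import Data.List.Relation.Binary.Sublist.Propositional using (_⊆_; []; _∷_; _∷ʳ_)
open import Data.List.Relation.Unary.All as All using (All; []; _∷_)
open import Data.Nat.Base as ℕ using (ℕ; zero; suc; z≤n; s≤s; s≤s⁻¹)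
import Data.Nat.Divisibility as ℕ
open import Data.Nat.GCD using (gcd; gcd[m,n]∣m; gcd[m,n]∣n; gcd-greatest)
open import Data.Nat.Primality using
  ( Prime; prime?; euclidsLemma; prime[2]; ¬prime[1]; prime⇒irreducible
  ; prime⇒nonZero; prime⇒nonTrivial)
import Data.Nat.Properties as ℕ
open import Data.Product.Base using (_×_; _,_; proj₁; proj₂; ∃-syntax; map₂)
open import Data.Sum.Base using (_⊎_; inj₁; inj₂)
open import Data.Unit.Base using (⊤; tt)
open import Function.Base using (_∘_)
open import Level using (0ℓ)
open import Relation.Binary.PropositionalEquality
  using (_≡_; _≢_; refl; sym; cong; cong₂; subst; module ≡-Reasoning)
  renaming (trans to ≡-trans)
open import Relation.Nullary.Decidable
  using (yes; no; decidable-stable; from-yes; _×-dec_; ¬?)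
open import Relation.Nullary.Negation using (¬_; contradiction)
open import Relation.Unary using (Pred; Decidable)

-- Searching a list up to permutation.

pick : ∀ {a p} {A : Set a} {P : Pred A p} → Decidable P → ∀ xs →
  (∃[ x ] ∃[ ys ] xs ↭ x ∷ ys × P x) ⊎ All (¬_ ∘ P) xs
pick P? [] = inj₂ []
pick P? (x ∷ xs) with P? x | pick P? xs
... | yes px | _ = inj₁ (x , xs , refl , px)
... | no ¬px | inj₁ (y , ys , xs↭ , py) =
      inj₁ (y , x ∷ ys , ↭-trans (prep x xs↭) (swap x y refl) , py)
... | no ¬px | inj₂ none = inj₂ (¬px ∷ none)

-- Integer vectors in the plane and their determinants.

module Plane where
  open import Data.Integer.Base using (_+_; _*_; -_; _-_)

  V : Set
  V = ℤ × ℤ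

  infixl 6 _⊹_
  infixr 7 _•_

  _⊹_ : V → V → V
  v ⊹ w = proj₁ v + proj₁ w , proj₂ v + proj₂ w

  _•_ : ℤ → V → V
  c • v = c * proj₁ v , c * proj₂ v

  0V e₁ e₂ : V
  0V = 0ℤ , 0ℤ
  e₁ = 1ℤ , 0ℤ
  e₂ = 0ℤ , 1ℤ

  det : V → V → ℤ
  det v w = proj₁ v * proj₂ w - proj₂ v * proj₁ w

  V-≡ : ∀ {v w : V} → proj₁ v ≡ proj₁ w → proj₂ v ≡ proj₂ w → v ≡ w
  V-≡ = cong₂ _,_

  combine : V → V → V → V
  combine f g w = proj₁ w • f ⊹ proj₂ w • g

  det-sym : ∀ v w → det w v ≡ - det v w
  det-sym v w = lem (proj₁ v) (proj₂ v) (proj₁ w) (proj₂ w)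
    where
    lem : ∀ a b c d → c * b - d * a ≡ - (a * d - b * c)
    lem = solve-∀

  det-self : ∀ v → det v v ≡ 0ℤ
  det-self v = lem (proj₁ v) (proj₂ v)
    where
    lem : ∀ a b → a * b - b * a ≡ 0ℤ
    lem = solve-∀

  det-linearˡ : ∀ c v w x → det (c • v ⊹ w) x ≡ det w x + c * det v x
  det-linearˡ c v w x = lem c (proj₁ v) (proj₂ v) (proj₁ w) (proj₂ w) (proj₁ x) (proj₂ x)
    where
    lem : ∀ c v₁ v₂ w₁ w₂ x₁ x₂ →
      (c * v₁ + w₁) * x₂ - (c * v₂ + w₂) * x₁ ≡ (w₁ * x₂ - w₂ * x₁) + c * (v₁ * x₂ - v₂ * x₁)
    lem = solve-∀

  det-linearʳ : ∀ c v w x → det x (c • v ⊹ w) ≡ det x w + c * det x v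
  det-linearʳ c v w x = lem c (proj₁ v) (proj₂ v) (proj₁ w) (proj₂ w) (proj₁ x) (proj₂ x)
    where
    lem : ∀ c v₁ v₂ w₁ w₂ x₁ x₂ →
      x₁ * (c * v₂ + w₂) - x₂ * (c * v₁ + w₁) ≡ (x₁ * w₂ - x₂ * w₁) + c * (x₁ * v₂ - x₂ * v₁)
    lem = solve-∀

  det-plücker : ∀ x y v w → det x y * det v w ≡ det x v * det y w - det x w * det y v
  det-plücker x y v w =
    lem (proj₁ x) (proj₂ x) (proj₁ y) (proj₂ y) (proj₁ v) (proj₂ v) (proj₁ w) (proj₂ w)
    where
    lem : ∀ a b c d e f g h → (a * d - b * c) * (e * h - f * g) ≡
      (a * f - b * e) * (c * h - d * g) - (a * h - b * g) * (c * f - d * e)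
    lem = solve-∀

  cramer : ∀ v w x →
    (- det x w) • v ⊹ ((- det v x) • w ⊹ det v w • x) ≡ 0V
  cramer v w x = V-≡
    (lem₁ (proj₁ v) (proj₂ v) (proj₁ w) (proj₂ w) (proj₁ x) (proj₂ x))
    (lem₂ (proj₁ v) (proj₂ v) (proj₁ w) (proj₂ w) (proj₁ x) (proj₂ x))
    where
    lem₁ : ∀ a b c d e f →
      - (e * d - f * c) * a + (- (a * f - b * e) * c + (a * d - b * c) * e) ≡ 0ℤ
    lem₁ = solve-∀
    lem₂ : ∀ a b c d e f →
      - (e * d - f * c) * b + (- (a * f - b * e) * d + (a * d - b * c) * f) ≡ 0ℤ
    lem₂ = solve-∀

  -- For the cases in which `w` is not among the selected vectors: the sum lies in a lattice as soon
  -- as `w` does, or as soon as p divides `det v x` and the lattice contains p times every vector.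
  cramer₂ : ∀ v w x → (- det x w) • v ⊹ det v w • x ≡ det v x • w
  cramer₂ v w x = V-≡
    (lem₁ (proj₁ v) (proj₂ v) (proj₁ w) (proj₂ w) (proj₁ x) (proj₂ x))
    (lem₂ (proj₁ v) (proj₂ v) (proj₁ w) (proj₂ w) (proj₁ x) (proj₂ x))
    where
    lem₁ : ∀ a b c d e f →
      - (e * d - f * c) * a + (a * d - b * c) * e ≡ (a * f - b * e) * c
    lem₁ = solve-∀
    lem₂ : ∀ a b c d e f →
      - (e * d - f * c) * b + (a * d - b * c) * f ≡ (a * f - b * e) * d
    lem₂ = solve-∀

  combine-⊹ : ∀ f g v w → combine f g (v ⊹ w) ≡ combine f g v ⊹ combine f g w
  combine-⊹ f g v w = V-≡
    (lem (proj₁ v) (proj₂ v) (proj₁ w) (proj₂ w) (proj₁ f) (proj₁ g))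
    (lem (proj₁ v) (proj₂ v) (proj₁ w) (proj₂ w) (proj₂ f) (proj₂ g))
    where
    lem : ∀ a b c d x y → (a + c) * x + (b + d) * y ≡ (a * x + b * y) + (c * x + d * y)
    lem = solve-∀

  combine-• : ∀ f g c v → combine f g (c • v) ≡ c • combine f g v
  combine-• f g c v = V-≡
    (lem c (proj₁ v) (proj₂ v) (proj₁ f) (proj₁ g))
    (lem c (proj₁ v) (proj₂ v) (proj₂ f) (proj₂ g))
    where
    lem : ∀ c a b x y → c * a * x + c * b * y ≡ c * (a * x + b * y)
    lem = solve-∀

-- Integers modulo an odd prime.

module Weights (p : ℕ) (p-prime : Prime p) (p-odd : ¬ (2 ℕ.∣ p)) where
  open import Data.Integer.Base using (_+_; _*_; -_; _-_)
  open import Data.Integer.Divisibility.Signed using (_∣_; _∣?_)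
  open Plane

  instance
    p-nonZero : ℕ.NonZero p
    p-nonZero = prime⇒nonZero p-prime

  ^-mono-∣ : ∀ {m n} → m ℕ.≤ n → p ℕ.^ m ℕ.∣ p ℕ.^ n
  ^-mono-∣ {m} {n} m≤n = ℕ.divides (p ℕ.^ (n ℕ.∸ m))
    (≡-trans (cong (p ℕ.^_) (sym (ℕ.m∸n+n≡m m≤n))) (ℕ.^-distribˡ-+-* p (n ℕ.∸ m) m))

  Zero Unit : ℤ → Set
  Zero x = + p ∣ x
  Unit x = ¬ Zero x

  zero? : Decidable Zero
  zero? x = + p ∣? x

  unit? : Decidable Unit
  unit? x = ¬? (zero? x)

  ¬unit⇒zero : ∀ {x} → ¬ Unit x → Zero x
  ¬unit⇒zero {x} = decidable-stable (zero? x)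

  zero-0 : Zero 0ℤ
  zero-0 = divides 0ℤ refl

  zero-*⁻ : ∀ x y → Zero (x * y) → Zero x ⊎ Zero y
  zero-*⁻ x y z with euclidsLemma ∣ x ∣ ∣ y ∣ p-prime (subst (p ℕ.∣_) (ℤ.abs-* x y) (∣⇒∣ᵤ z))
  ... | inj₁ zx = inj₁ (∣ᵤ⇒∣ zx)
  ... | inj₂ zy = inj₂ (∣ᵤ⇒∣ zy)

  unit-*-zero : ∀ {x y} → Unit x → Zero (x * y) → Zero y
  unit-*-zero {x} {y} ux z with zero-*⁻ x y z
  ... | inj₁ zx = contradiction zx ux
  ... | inj₂ zy = zy

  unit-* : ∀ {x y} → Unit x → Unit y → Unit (x * y)
  unit-* ux uy z = uy (unit-*-zero ux z)

  unit-neg : ∀ {x} → Unit x → Unit (- x)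
  unit-neg {x} ux z = ux (subst Zero (ℤ.neg-involutive x) (∣m⇒∣-m z))

  unit-+zero : ∀ {x y} → Unit x → Zero y → Unit (x + y)
  unit-+zero ux zy z = ux (∣m+n∣n⇒∣m z zy)

  p∤1 : ¬ (p ℕ.∣ 1)
  p∤1 p∣1 with ℕ.∣1⇒≡1 p∣1
  ... | refl = ¬prime[1] p-prime

  unit-1 : Unit 1ℤ
  unit-1 z = p∤1 (∣⇒∣ᵤ z)

  prime∣prime : ∀ {q} → Prime q → p ℕ.∣ q → p ≡ q
  prime∣prime q-prime p∣q with prime⇒irreducible q-prime p∣q
  ... | inj₁ refl = ⊥-elim (p∤1 ℕ.∣-refl)
  ... | inj₂ eq = eq

  unit-2 : Unit (+ 2)
  unit-2 z with prime∣prime prime[2] (∣⇒∣ᵤ z)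
  ... | refl = p-odd ℕ.∣-refl

  unit-3 : p ≢ 3 → Unit (+ 3)
  unit-3 p≢3 z = p≢3 (prime∣prime (from-yes (prime? 3)) (∣⇒∣ᵤ z))

  unit-det-sym : ∀ v w → Unit (det v w) → Unit (det w v)
  unit-det-sym v w u = subst Unit (sym (det-sym v w)) (unit-neg u)

  zero-det-sym : ∀ v w → Zero (det v w) → Zero (det w v)
  zero-det-sym v w z = subst Zero (sym (det-sym v w)) (∣m⇒∣-m z)

  -- Units mod 3 are congruent to 1 or -1, so two incongruent ones are opposite.
  unit-mod-3 : p ≡ 3 → ∀ {x y} → Unit x → Unit y → Unit (x - y) → Zero (x + y)
  unit-mod-3 refl {x} {y} ux uy u with sign ux | sign uy
    where
    sign : ∀ {x} → Unit x → Zero (x - 1ℤ) ⊎ Zero (x + 1ℤ)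
    sign {x} ux = go (x ℤ.%ℕ 3) (ℤ.n%ℕd<d x 3) (ℤ.a≡a%ℕn+[a/ℕn]*n x 3)
      where
      q : ℤ
      q = x ℤ./ℕ 3
      lem₁ : ∀ q → (1ℤ + q * + 3) - 1ℤ ≡ q * + 3
      lem₁ = solve-∀
      lem₂ : ∀ q → (+ 2 + q * + 3) + 1ℤ ≡ (q + 1ℤ) * + 3
      lem₂ = solve-∀
      go : ∀ r → r ℕ.< 3 → x ≡ + r + q * + 3 → Zero (x - 1ℤ) ⊎ Zero (x + 1ℤ)
      go 0 _ eq = ⊥-elim (ux (divides q (≡-trans eq (ℤ.+-identityˡ (q * + 3)))))
      go 1 _ eq = inj₁ (divides q (≡-trans (cong (_- 1ℤ) eq) (lem₁ q)))
      go 2 _ eq = inj₂ (divides (q + 1ℤ) (≡-trans (cong (_+ 1ℤ) eq) (lem₂ q)))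
      go (suc (suc (suc _))) (s≤s (s≤s (s≤s ()))) _
  ... | inj₁ zx | inj₁ zy = contradiction (subst Zero (lem x y) (∣m∣n⇒∣m-n zx zy)) u
    where
    lem : ∀ x y → (x - 1ℤ) - (y - 1ℤ) ≡ x - y
    lem = solve-∀
  ... | inj₁ zx | inj₂ zy = subst Zero (lem x y) (∣m∣n⇒∣m+n zx zy)
    where
    lem : ∀ x y → (x - 1ℤ) + (y + 1ℤ) ≡ x + y
    lem = solve-∀
  ... | inj₂ zx | inj₁ zy = subst Zero (lem x y) (∣m∣n⇒∣m+n zx zy)
    where
    lem : ∀ x y → (x + 1ℤ) + (y - 1ℤ) ≡ x + y
    lem = solve-∀
  ... | inj₂ zx | inj₂ zy = contradiction (subst Zero (lem x y) (∣m∣n⇒∣m-n zx zy)) u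
    where
    lem : ∀ x y → (x + 1ℤ) - (y + 1ℤ) ≡ x - y
    lem = solve-∀

  -- The projective line over the field with three elements has only four points.
  five-directions : p ≡ 3 → ∀ {x y z v w} → Unit (det x y) → Unit (det x z) → Unit (det y z) →
    Unit (det x v) → Unit (det y v) → Unit (det z v) →
    Unit (det x w) → Unit (det y w) → Unit (det z w) → Zero (det v w)
  five-directions p≡3 {x} {y} {z} {v} {w} uxy uxz uyz uxv uyv uzv uxw uyw uzw =
    unit-*-zero uxy (subst Zero (sym (det-plücker x y v w)) (unit-*-zero (unit-* uxz uyz)
      (subst Zero (lem (det x z) (det y z) (det x v) (det y v) (det x w) (det y w))
        (∣m∣n⇒∣m-n (∣m⇒∣m*n (det x z * det y w) (opposite uxv uyv uzv))
                   (∣m⇒∣m*n (det x z * det y v) (opposite uxw uyw uzw))))))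
    where
    -- By the Plücker relation the two products differ by a unit, so they are opposite mod 3. Hence
    -- the ratio of `det x t` to `det y t` mod 3 does not depend on `t`, and `v` and `w` have the
    -- same direction.
    opposite : ∀ {t} → Unit (det x t) → Unit (det y t) → Unit (det z t) →
      Zero (det x z * det y t + det x t * det y z)
    opposite {t} uxt uyt uzt = unit-mod-3 p≡3 (unit-* uxz uyt) (unit-* uxt uyz)
      (subst Unit (det-plücker x y z t) (unit-* uxy uzt))
    lem : ∀ xz yz xv yv xw yw →
      (xz * yv + xv * yz) * (xz * yw) - (xz * yw + xw * yz) * (xz * yv) ≡
      (xz * yz) * (xv * yw - xw * yv)
    lem = solve-∀

  -- Weighted sums of a prescribed number of vectors.

  -- Comb vs n w: the sum w arises from n entries of vs, at distinct positions, with
  -- unit weights.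
  data Comb : List V → ℕ → V → Set where
    []   : Comb [] 0 0V
    skip : ∀ {v vs n w} → Comb vs n w → Comb (v ∷ vs) n w
    take : ∀ {v vs n w} u → Unit u → Comb vs n w → Comb (v ∷ vs) (suc n) (u • v ⊹ w)

  comb-∅ : ∀ vs → Comb vs 0 0V
  comb-∅ []       = []
  comb-∅ (_ ∷ vs) = skip (comb-∅ vs)

  comb-≡ : ∀ {vs n w w′} → w ≡ w′ → Comb vs n w → Comb vs n w′
  comb-≡ refl c = c

  comb-[_] : ∀ v vs → Comb (v ∷ vs) 1 v
  comb-[ v ] vs = comb-≡ (V-≡ (lem (proj₁ v)) (lem (proj₂ v))) (take 1ℤ unit-1 (comb-∅ vs))
    where
    lem : ∀ x → 1ℤ * x + 0ℤ ≡ x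
    lem = solve-∀

  comb-• : ∀ {vs n w c} → Unit c → Comb vs n w → Comb vs n (c • w)
  comb-• {c = c} uc [] = comb-≡ (V-≡ (sym (ℤ.*-zeroʳ c)) (sym (ℤ.*-zeroʳ c))) []
  comb-• uc (skip x) = skip (comb-• uc x)
  comb-• {c = c} uc (take {v} {w = w} u uu x) =
    comb-≡ (V-≡ (lem c u (proj₁ v) (proj₁ w)) (lem c u (proj₂ v) (proj₂ w)))
      (take (c * u) (unit-* uc uu) (comb-• uc x))
    where
    lem : ∀ c u a b → c * u * a + c * b ≡ c * (u * a + b)
    lem = solve-∀

  comb-↭ : ∀ {vs vs′ n w} → vs ↭ vs′ → Comb vs n w → Comb vs′ n w
  comb-↭ refl c = c
  comb-↭ (trans π ρ) c = comb-↭ ρ (comb-↭ π c)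
  comb-↭ (prep v π) (skip c) = skip (comb-↭ π c)
  comb-↭ (prep v π) (take u uu c) = take u uu (comb-↭ π c)
  comb-↭ (swap v v′ π) (skip (skip c)) = skip (skip (comb-↭ π c))
  comb-↭ (swap v v′ π) (skip (take u uu c)) = take u uu (skip (comb-↭ π c))
  comb-↭ (swap v v′ π) (take u uu (skip c)) = skip (take u uu (comb-↭ π c))
  comb-↭ (swap v v′ π) (take u uu (take {w = w} u′ uu′ c)) =
    comb-≡ (V-≡ (lem (u′ * proj₁ v′) (u * proj₁ v) (proj₁ w)) (lem (u′ * proj₂ v′) (u * proj₂ v) (proj₂ w)))
      (take u′ uu′ (take u uu (comb-↭ π c)))
    where
    lem : ∀ a b c → a + (b + c) ≡ b + (a + c)
    lem = solve-∀

  comb-cramer : ∀ {v w vs n x} → Unit (det v w) → Unit (det x w) → Unit (det v x) →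
    Comb vs n x → Comb (v ∷ w ∷ vs) (2 ℕ.+ n) 0V
  comb-cramer {v} {w} {x = x} uvw uxw uvx c =
    comb-≡ (cramer v w x) (take _ (unit-neg uxw) (take _ (unit-neg uvx) (comb-• uvw c)))

  -- Greedy choice of weights: `P` is the invariant of the partial sums, `Q` what is known of the
  -- vectors still to be added. The sum starts at `v` with weight 1.
  extend : ∀ {P Q : Pred V 0ℓ} →
    (∀ {w} v → P w → Q v → ∃[ u ] Unit u × P (u • v ⊹ w)) →
    ∀ {v vs} m → P v → All Q vs → m ℕ.≤ length vs →
    ∃[ w ] Comb (v ∷ vs) (suc m) w × P w
  extend step {v} {vs} zero Pv _ _ = v , comb-[ v ] vs , Pv
  extend step {v} {v′ ∷ vs} (suc m) Pv (Qv′ ∷ Qvs) (s≤s m≤)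
    with extend step m Pv Qvs m≤
  ... | w , c , Pw with step v′ Pw Qv′
  ... | u , uu , Pw′ = u • v′ ⊹ w , comb-↭ (swap v′ v refl) (take u uu c) , Pw′

  -- The two weights ±1 cannot both fail, since (x + y) + (x − y) = 2x.
  avoid₁ : ∀ {x} → Unit x → ∀ y → ∃[ u ] Unit u × Unit (x + u * y)
  avoid₁ {x} ux y with zero? (x + 1ℤ * y)
  ... | no u = 1ℤ , unit-1 , u
  ... | yes z = -1ℤ , unit-neg unit-1 , λ z′ →
        unit-* unit-2 ux (subst Zero (lem x y) (∣m∣n⇒∣m+n z z′))
    where
    lem : ∀ x y → (x + 1ℤ * y) + (x + -1ℤ * y) ≡ + 2 * x
    lem = solve-∀

  -- Each of the two conditions excludes at most one of the weights 1, −1, 2.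
  avoid₂ : Unit (+ 3) → ∀ {x x′} → Unit x → Unit x′ → ∀ y y′ →
    ∃[ u ] Unit u × Unit (x + u * y) × Unit (x′ + u * y′)
  avoid₂ unit-3 {x} {x′} ux ux′ y y′ = go
    where
    -- If both weights failed, p would divide (u′ - u) x.
    clash : ∀ u u′ → Unit (u′ - u) → ∀ {x y} → Unit x → Zero (x + u * y) → Unit (x + u′ * y)
    clash u u′ d {x} {y} ux z z′ = unit-* d ux
      (subst Zero (lem u u′ x y) (∣m∣n⇒∣m-n (∣n⇒∣m*n u′ z) (∣n⇒∣m*n u z′)))
      where
      lem : ∀ u u′ x y → u′ * (x + u * y) - u * (x + u′ * y) ≡ (u′ - u) * x
      lem = solve-∀

    go : ∃[ u ] Unit u × Unit (x + u * y) × Unit (x′ + u * y′)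
    go with zero? (x + 1ℤ * y) | zero? (x′ + 1ℤ * y′) | zero? (x + -1ℤ * y) | zero? (x′ + -1ℤ * y′)
    ... | no a  | no b  | _     | _     = 1ℤ , unit-1 , a , b
    ... | _     | _     | no a  | no b  = -1ℤ , unit-neg unit-1 , a , b
    ... | yes a | _     | yes b | _     = contradiction b (clash 1ℤ -1ℤ (unit-neg unit-2) ux a)
    ... | _     | yes a | _     | yes b = contradiction b (clash 1ℤ -1ℤ (unit-neg unit-2) ux′ a)
    -- In the last two cases each condition has already excluded one of 1 and -1. The weight 2
    -- differs from these by the units 1 and 3, so it passes both.
    ... | yes a | no _  | no _  | yes b =
          + 2 , unit-2 , clash 1ℤ (+ 2) unit-1 ux a , clash -1ℤ (+ 2) unit-3 ux′ b
    ... | no _  | yes a | yes b | no _  =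
          + 2 , unit-2 , clash -1ℤ (+ 2) unit-3 ux b , clash 1ℤ (+ 2) unit-1 ux′ a

  -- Sublattices of ℤ²

  -- Only containment of the two multiples is required, so a change of coordinates leaves just two
  -- memberships to check.
  record Lattice (a b : ℕ) : Set₁ where
    field
      Mem   : Pred V 0ℓ
      add   : ∀ {v w} → Mem v → Mem w → Mem (v ⊹ w)
      scale : ∀ c {v} → Mem v → Mem (c • v)
      mem₁  : Mem (+ (p ℕ.^ a) • e₁)
      mem₂  : Mem (+ (p ℕ.^ b) • e₂)

    mem-≡ : ∀ {v w} → v ≡ w → Mem v → Mem w
    mem-≡ = subst Mem

    mem-combine : ∀ {f g} w → Mem f → Mem g → Mem (combine f g w)
    mem-combine w Mf Mg = add (scale (proj₁ w) Mf) (scale (proj₂ w) Mg)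

    mem-0 : Mem 0V
    mem-0 = scale 0ℤ mem₁

  open Lattice

  pullback : ∀ {a b a′ b′} (K : Lattice a b) f g →
    Mem K (+ (p ℕ.^ a′) • f) → Mem K (+ (p ℕ.^ b′) • g) → Lattice a′ b′
  pullback {a′ = a′} {b′} K f g Mf Mg = record
    { Mem   = Mem K ∘ combine f g
    ; add   = λ {v} {w} Mv Mw → mem-≡ K (sym (combine-⊹ f g v w)) (add K Mv Mw)
    ; scale = λ c {v} Mv → mem-≡ K (sym (combine-• f g c v)) (scale K c Mv)
    ; mem₁  = mem-≡ K (V-≡ (lem₁ pᵃ (proj₁ f) (proj₁ g)) (lem₁ pᵃ (proj₂ f) (proj₂ g))) Mf
    ; mem₂  = mem-≡ K (V-≡ (lem₂ pᵇ (proj₁ f) (proj₁ g)) (lem₂ pᵇ (proj₂ f) (proj₂ g))) Mg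
    }
    where
    pᵃ pᵇ : ℤ
    pᵃ = + (p ℕ.^ a′)
    pᵇ = + (p ℕ.^ b′)
    lem₁ : ∀ c x y → c * x ≡ c * 1ℤ * x + c * 0ℤ * y
    lem₁ = solve-∀
    lem₂ : ∀ c x y → c * y ≡ c * 0ℤ * x + c * 1ℤ * y
    lem₂ = solve-∀

  -- The factor `c` can be absorbed into the weight of `v`; allowing it avoids inverting units
  -- modulo powers of p.
  UnitSpan : V → V → V → Set
  UnitSpan f g v = ∃[ c ] Unit c × ∃[ w ] c • v ≡ combine f g w

  reframe : ∀ {f g vs} → All (UnitSpan f g) vs →
    ∃[ ws ] length ws ≡ length vs × (∀ {n w} → Comb ws n w → Comb vs n (combine f g w))
  reframe {f} {g} [] = [] , refl , λ { [] → [] }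
  reframe {f} {g} {v ∷ _} ((c , uc , w , eq) ∷ spans) with reframe spans
  ... | ws , len , lift = w ∷ ws , cong suc len , λ
      { (skip x) → skip (lift x)
      ; (take {w = y} u uu x) → comb-≡ (lem u y) (take (u * c) (unit-* uu uc) (lift x)) }
    where
    lem : ∀ u y → (u * c) • v ⊹ combine f g y ≡ combine f g (u • w ⊹ y)
    lem u y = begin
      (u * c) • v ⊹ combine f g y             ≡⟨ cong (_⊹ combine f g y) (V-≡ (ℤ.*-assoc u c _) (ℤ.*-assoc u c _)) ⟩
      u • (c • v) ⊹ combine f g y             ≡⟨ cong (λ z → u • z ⊹ combine f g y) eq ⟩
      u • combine f g w ⊹ combine f g y       ≡⟨ cong (_⊹ combine f g y) (sym (combine-• f g u w)) ⟩
      combine f g (u • w) ⊹ combine f g y     ≡⟨ sym (combine-⊹ f g (u • w) y) ⟩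
      combine f g (u • w ⊹ y)                 ∎
      where open ≡-Reasoning

  -- Selecting e vectors with a weighted sum in a lattice.

  module Selection (k : ℕ) where

    e : ℕ
    e = 3 ℕ.+ k

    Selects : ∀ {a b} → Lattice a b → List V → Set
    Selects K vs = ∃[ w ] Comb vs e w × Mem K w

    Claim : ℕ → ℕ → Set₁
    Claim a b = (K : Lattice a b) → ∀ vs → e ℕ.+ (a ℕ.+ b) ℕ.≤ length vs → Selects K vs

    selects-↭ : ∀ {a b} {K : Lattice a b} {vs vs′} → vs ↭ vs′ → Selects K vs′ → Selects K vs
    selects-↭ π (w , c , Mw) = w , comb-↭ (↭-sym π) c , Mw

    selects-∷ : ∀ {a b} {K : Lattice a b} {v vs} → Selects K vs → Selects K (v ∷ vs)
    selects-∷ (w , c , Mw) = w , skip c , Mw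

    descend : ∀ {a b a′ b′} → Claim a′ b′ → (K : Lattice a b) → ∀ f g →
      Mem K (+ (p ℕ.^ a′) • f) → Mem K (+ (p ℕ.^ b′) • g) →
      ∀ {vs} → All (UnitSpan f g) vs → e ℕ.+ (a′ ℕ.+ b′) ℕ.≤ length vs → Selects K vs
    descend claim K f g Mf Mg spans len with reframe spans
    ... | ws , len′ , lift
      with claim (pullback K f g Mf Mg) ws (ℕ.≤-trans len (ℕ.≤-reflexive (sym len′)))
    ... | w , c , Mw = combine f g w , lift c , Mw

    mem-^-mono : ∀ {a b c d} (K : Lattice a b) {v} → c ℕ.≤ d →
      Mem K (+ (p ℕ.^ c) • v) → Mem K (+ (p ℕ.^ d) • v)
    mem-^-mono {c = c} {d} K {v} c≤d Mv with ^-mono-∣ c≤d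
    ... | ℕ.divides q p^d≡ = mem-≡ K (V-≡ (eq (proj₁ v)) (eq (proj₂ v))) (scale K (+ q) Mv)
      where
      eq : ∀ x → + q * (+ (p ℕ.^ c) * x) ≡ + (p ℕ.^ d) * x
      eq x = ≡-trans (sym (ℤ.*-assoc (+ q) (+ (p ℕ.^ c)) x))
        (cong (_* x) (≡-trans (sym (ℤ.pos-* q (p ℕ.^ c))) (cong +_ (sym p^d≡))))

    mem-^ : ∀ {a b c} (K : Lattice a b) → a ℕ.≤ c → b ℕ.≤ c → ∀ v → Mem K (+ (p ℕ.^ c) • v)
    mem-^ {c = c} K a≤c b≤c v =
      mem-≡ K (V-≡ (lem₁ (+ (p ℕ.^ c)) (proj₁ v) (proj₂ v)) (lem₂ (+ (p ℕ.^ c)) (proj₁ v) (proj₂ v)))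
        (mem-combine K v (mem-^-mono K a≤c (mem₁ K)) (mem-^-mono K b≤c (mem₂ K)))
      where
      lem₁ : ∀ c x y → x * (c * 1ℤ) + y * (c * 0ℤ) ≡ c * x
      lem₁ = solve-∀
      lem₂ : ∀ c x y → x * (c * 0ℤ) + y * (c * 1ℤ) ≡ c * y
      lem₂ = solve-∀

    mem-^-suc : ∀ {a b} (K : Lattice a b) n {v} →
      Mem K (+ (p ℕ.^ suc n) • v) → Mem K (+ (p ℕ.^ n) • + p • v)
    mem-^-suc K n {v} = mem-≡ K (V-≡ (eq (proj₁ v)) (eq (proj₂ v)))
      where
      lem : ∀ p q x → p * q * x ≡ q * (p * x)
      lem = solve-∀
      eq : ∀ x → + (p ℕ.^ suc n) * x ≡ + (p ℕ.^ n) * (+ p * x)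
      eq x = ≡-trans (cong (_* x) (ℤ.pos-* p (p ℕ.^ n))) (lem (+ p) (+ (p ℕ.^ n)) x)

    -- Vectors on one line mod p.

    span-zero₁ : ∀ {v} → Zero (proj₁ v) → UnitSpan (+ p • e₁) e₂ v
    span-zero₁ {x , y} (divides q refl) =
      1ℤ , unit-1 , (q , y) , V-≡ (lem₁ q (+ p) y) (lem₂ q (+ p) y)
      where
      lem₁ : ∀ q p y → 1ℤ * (q * p) ≡ q * (p * 1ℤ) + y * 0ℤ
      lem₁ = solve-∀
      lem₂ : ∀ q p y → 1ℤ * y ≡ q * (p * 0ℤ) + y * 1ℤ
      lem₂ = solve-∀

    span-zero₂ : ∀ {v} → Zero (proj₂ v) → UnitSpan e₁ (+ p • e₂) v
    span-zero₂ {x , y} (divides q refl) =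
      1ℤ , unit-1 , (x , q) , V-≡ (lem₁ q (+ p) x) (lem₂ q (+ p) x)
      where
      lem₁ : ∀ q p x → 1ℤ * x ≡ x * 1ℤ + q * (p * 0ℤ)
      lem₁ = solve-∀
      lem₂ : ∀ q p x → 1ℤ * (q * p) ≡ x * 0ℤ + q * (p * 1ℤ)
      lem₂ = solve-∀

    span-swap : ∀ v → UnitSpan e₂ e₁ v
    span-swap (x , y) = 1ℤ , unit-1 , (y , x) , V-≡ (lem₁ x y) (lem₂ x y)
      where
      lem₁ : ∀ x y → 1ℤ * x ≡ y * 0ℤ + x * 1ℤ
      lem₁ = solve-∀
      lem₂ : ∀ x y → 1ℤ * y ≡ y * 1ℤ + x * 0ℤ
      lem₂ = solve-∀

    -- No inverse of the unit d₁ is needed: d₁ v = v₁ d + det d v e₂.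
    span-line₁ : ∀ {d v} → Unit (proj₁ d) → Zero (det d v) → UnitSpan d (+ p • e₂) v
    span-line₁ {d₁ , d₂} {x , y} ud (divides q eq) =
      d₁ , ud , (x , q) , V-≡ (lem₁ d₁ x q (+ p))
        (≡-trans (lem₂ d₁ d₂ x y) (≡-trans (cong (λ z → x * d₂ + z) eq) (lem₃ (x * d₂) q (+ p))))
      where
      lem₁ : ∀ d₁ x q p → d₁ * x ≡ x * d₁ + q * (p * 0ℤ)
      lem₁ = solve-∀
      lem₂ : ∀ d₁ d₂ x y → d₁ * y ≡ x * d₂ + (d₁ * y - d₂ * x)
      lem₂ = solve-∀
      lem₃ : ∀ z q p → z + q * p ≡ z + q * (p * 1ℤ)
      lem₃ = solve-∀

    span-line₂ : ∀ {d v} → Unit (proj₂ d) → Zero (det d v) → UnitSpan (+ p • e₁) d v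
    span-line₂ {d₁ , d₂} {x , y} ud (divides q eq) =
      d₂ , ud , (- q , y) , V-≡
        (≡-trans (lem₂ d₁ d₂ x y) (≡-trans (cong (λ z → - z + y * d₁) eq) (lem₃ (y * d₁) q (+ p))))
        (lem₁ d₂ y q (+ p))
      where
      lem₁ : ∀ d₂ y q p → d₂ * y ≡ - q * (p * 0ℤ) + y * d₂
      lem₁ = solve-∀
      lem₂ : ∀ d₁ d₂ x y → d₂ * x ≡ - (d₁ * y - d₂ * x) + y * d₁
      lem₂ = solve-∀
      lem₃ : ∀ z q p → - (q * p) + z ≡ - q * (p * 1ℤ) + z
      lem₃ = solve-∀

    NonZeroMod : V → Set
    NonZeroMod d = ¬ (Zero (proj₁ d) × Zero (proj₂ d))

    unit-det⇒nonZero : ∀ {v w} → Unit (det v w) → NonZeroMod v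
    unit-det⇒nonZero {w = w} u (z₁ , z₂) =
      u (∣m∣n⇒∣m-n (∣m⇒∣m*n (proj₂ w) z₁) (∣m⇒∣m*n (proj₁ w) z₂))

    -- A sublattice of index p contains vs. The case split on a and b keeps the
    -- exponent bound for the new basis vector d.
    on-line : ∀ {a b} → Claim a (suc b) → Claim (suc a) b → (K : Lattice (suc a) (suc b)) →
      ∀ d → NonZeroMod d → ∀ {vs} → All (Zero ∘ det d) vs →
      e ℕ.+ (a ℕ.+ suc b) ℕ.≤ length vs → Selects K vs
    on-line {a} {b} claim₁ claim₂ K d d≢0 {vs} zs len
      with zero? (proj₁ d) | zero? (proj₂ d) | ℕ.≤-total b a
    ... | yes z₁ | yes z₂ | _ = contradiction (z₁ , z₂) d≢0
    -- Modulo p the line is spanned by `e₂`, so the first coordinates of `vs` vanish mod p.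
    ... | yes z₁ | no u₂ | _ =
          descend claim₁ K (+ p • e₁) e₂ (mem-^-suc K a (mem₁ K)) (mem₂ K)
            (All.map (λ {v} z → span-zero₁ {v} (unit-*-zero u₂ (reduce v z))) zs) len
      where
      lem : ∀ d₁ d₂ x y → d₁ * y - (d₁ * y - d₂ * x) ≡ d₂ * x
      lem = solve-∀
      reduce : ∀ v → Zero (det d v) → Zero (proj₂ d * proj₁ v)
      reduce v z = subst Zero (lem (proj₁ d) (proj₂ d) (proj₁ v) (proj₂ v))
        (∣m∣n⇒∣m-n (∣m⇒∣m*n (proj₂ v) z₁) z)
    ... | no u₁ | yes z₂ | _ =
          descend claim₂ K e₁ (+ p • e₂) (mem₁ K) (mem-^-suc K b (mem₂ K))
            (All.map (λ {v} z → span-zero₂ {v} (unit-*-zero u₁ (reduce v z))) zs) len′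
      where
      lem : ∀ d₁ d₂ x y → (d₁ * y - d₂ * x) + d₂ * x ≡ d₁ * y
      lem = solve-∀
      reduce : ∀ v → Zero (det d v) → Zero (proj₁ d * proj₂ v)
      reduce v z = subst Zero (lem (proj₁ d) (proj₂ d) (proj₁ v) (proj₂ v))
        (∣m∣n⇒∣m+n z (∣m⇒∣m*n (proj₁ v) z₂))
      len′ : e ℕ.+ (suc a ℕ.+ b) ℕ.≤ length vs
      len′ = subst (λ n → e ℕ.+ n ℕ.≤ length vs) (ℕ.+-suc a b) len
    -- `d` replaces the basis vector with the larger exponent, since only the larger power of p is
    -- sure to carry `d` into K.
    ... | no u₁ | no u₂ | inj₁ b≤a =
          descend claim₂ K d (+ p • e₂) (mem-^ K ℕ.≤-refl (s≤s b≤a) d) (mem-^-suc K b (mem₂ K))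
            (All.map (span-line₁ u₁) zs) (subst (λ n → e ℕ.+ n ℕ.≤ length vs) (ℕ.+-suc a b) len)
    ... | no u₁ | no u₂ | inj₂ a≤b =
          descend claim₁ K (+ p • e₁) d (mem-^-suc K a (mem₁ K)) (mem-^ K (s≤s a≤b) ℕ.≤-refl d)
            (All.map (span-line₂ u₂) zs) len

    -- Since `e₂` lies in K, only first coordinates matter. If two vectors have unit first
    -- coordinates, build from one of them a sum `x` of e - 1 vectors with unit first coordinate and
    -- cancel it against the other, `v`. If not, drop at most one vector and divide the first
    -- coordinates by p. For a = 0 the lattice is everything.
    claim-rank₁ : ∀ a → Claim a 0
    claim-rank₁ zero K (v ∷ vs) (s≤s len)
      with extend {P = λ _ → ⊤} {Q = λ _ → ⊤} (λ _ _ _ → 1ℤ , unit-1 , tt) {v} {vs} (2 ℕ.+ k) tt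
             (All.universal (λ _ → tt) vs) (ℕ.m+n≤o⇒m≤o (2 ℕ.+ k) len)
    ... | w , c , _ = w , c , mem-≡ K (V-≡ (ℤ.*-identityˡ _) (ℤ.*-identityˡ _)) (mem-^ {c = 0} K z≤n z≤n w)
    claim-rank₁ (suc a) K vs len with pick (unit? ∘ proj₁) vs
    ... | inj₂ zs =
          descend (claim-rank₁ a) K (+ p • e₁) e₂ (mem-^-suc K a (mem₁ K)) (mem₂ K)
            (All.map (λ {v} ¬u → span-zero₁ {v} (¬unit⇒zero ¬u)) zs)
            (ℕ.≤-trans (ℕ.+-monoʳ-≤ e (ℕ.n≤1+n (a ℕ.+ 0))) len)
    ... | inj₁ (v , vs′ , π , uv) with pick (unit? ∘ proj₁) vs′ | ℕ.≤-trans len (ℕ.≤-reflexive (↭-length π))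
    ...   | inj₂ zs | len′ = selects-↭ {K = K} π (selects-∷ {K = K}
          (descend (claim-rank₁ a) K (+ p • e₁) e₂ (mem-^-suc K a (mem₁ K)) (mem₂ K)
            (All.map (λ {v} ¬u → span-zero₁ {v} (¬unit⇒zero ¬u)) zs)
            (s≤s⁻¹ (ℕ.≤-trans (ℕ.≤-reflexive (sym (ℕ.+-suc e (a ℕ.+ 0)))) len′))))
    ...   | inj₁ (w , vs″ , ρ , uw) | len′
          with extend {P = Unit ∘ proj₁} {Q = λ _ → ⊤}
                 (λ {w} v uw _ → map₂ (map₂ (subst Unit (ℤ.+-comm (proj₁ w) _))) (avoid₁ uw (proj₁ v)))
                 {w} {vs″} (suc k) uw (All.universal (λ _ → tt) vs″)
                 (s≤s⁻¹ (s≤s⁻¹ (ℕ.≤-trans (ℕ.m≤m+n (3 ℕ.+ k) (suc a ℕ.+ 0))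
                   (ℕ.≤-trans len′ (s≤s (ℕ.≤-reflexive (↭-length ρ)))))))
    ...     | x , c , ux = selects-↭ {K = K} (↭-trans π (prep v ρ))
              ( _
              , take (- det x e₂) (unit-neg (subst Unit (sym (det-e₂ x)) ux))
                  (comb-• (subst Unit (sym (det-e₂ v)) uv) c)
              , mem-≡ K (sym (cramer₂ v e₂ x)) (scale K (det v x)
                  (mem-≡ K (V-≡ refl refl) (mem₂ K))))
            where
            lem : ∀ a b → a * 1ℤ - b * 0ℤ ≡ a
            lem = solve-∀
            det-e₂ : ∀ v → det v e₂ ≡ proj₁ v
            det-e₂ v = lem (proj₁ v) (proj₂ v)

    -- Vectors in several directions mod p.

    extend-det : ∀ y {v vs} m → Unit (det y v) → m ℕ.≤ length vs →
      ∃[ w ] Comb (v ∷ vs) (suc m) w × Unit (det y w)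
    extend-det y {vs = vs} m u m≤ =
      extend {P = Unit ∘ det y} {Q = λ _ → ⊤} step m u (All.universal (λ _ → tt) vs) m≤
      where
      step : ∀ {w} v → Unit (det y w) → ⊤ → ∃[ u ] Unit u × Unit (det y (u • v ⊹ w))
      step {w} v uw _ with avoid₁ uw (det y v)
      ... | u , uu , u′ = u , uu , subst Unit (sym (det-linearʳ u v w y)) u′

    -- Cramer's rule for three pairwise independent vectors alone: its coefficients are the three
    -- determinants up to sign. For e = 3 this is a complete selection.
    circuit : ∀ {v x y vs} → Unit (det v x) → Unit (det v y) → Unit (det x y) →
      Comb (v ∷ x ∷ y ∷ vs) 3 0V
    circuit {x = x} {y} {vs} uvx uvy uxy = comb-cramer uvx (unit-det-sym x y uxy) uvy (comb-[ y ] vs)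

    -- With `y` the sum of `v′` and a suitable multiple of `z`, Cramer's rule for `v`, `x`, `y`
    -- leaves the multiple `det v y` of `x`, which is in pℤ² because `v`, `v′`, `z` lie on a line
    -- mod p. The vector `z` may vanish mod p.
    collinear : (K : Lattice 1 1) → ∀ {v v′ z} x {vs} → Zero (det v v′) → Zero (det v z) →
      Unit (det v x) → Unit (det v′ x) → ∃[ w ] Comb (v ∷ v′ ∷ z ∷ vs) 3 w × Mem K w
    collinear K {v} {v′} {z} x {vs} zv′ zz uv uv′ with avoid₁ uv′ (det z x)
    ... | u , uu , uy = _
        , comb-↭ (prep v (swap z v′ refl)) (take (- det y x) (unit-neg uyx) (comb-• uv (take u uu (comb-[ v′ ] vs))))
        , mem-≡ K (sym (cramer₂ v x y)) (mem-zero (det v y) zy)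
      where
      y : V
      y = u • z ⊹ v′
      uyx : Unit (det y x)
      uyx = subst Unit (sym (det-linearˡ u z v′ x)) uy
      zy : Zero (det v y)
      zy = subst Zero (sym (det-linearʳ u z v′ v)) (∣m∣n⇒∣m+n zv′ (∣n⇒∣m*n u zz))
      mem-zero : ∀ c → Zero c → Mem K (c • x)
      mem-zero c (divides q refl) = mem-≡ K (V-≡ (eq (proj₁ x)) (eq (proj₂ x)))
        (scale K q (mem-^ {c = 1} K ℕ.≤-refl ℕ.≤-refl x))
        where
        eq : ∀ t → q * (+ (p ℕ.* 1) * t) ≡ q * + p * t
        eq t = ≡-trans (cong (λ n → q * (+ n * t)) (ℕ.*-identityʳ p)) (sym (ℤ.*-assoc q (+ p) t))

    -- The weight of v′ makes det w x a unit at the end without changing det v w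
    -- mod p, so the other weights need only take care of the latter. This takes four
    -- vectors; for e = 3 three collinear ones may be needed, which suffice as pℤ² ⊆ K.
    parallel-pair : ∀ {a b} (K : Lattice (suc a) (suc b)) → (k ≡ 0 → a ≡ 0 × b ≡ 0) →
      ∀ {v v′ x y vs} → suc k ℕ.≤ length vs → Zero (det v v′) →
      Unit (det v x) → Unit (det v′ x) → Unit (det v y) → Selects K (v ∷ v′ ∷ x ∷ y ∷ vs)
    parallel-pair K small {v} {v′} {x} {y} {z ∷ vs} (s≤s k≤) zvv′ uvx uv′x uvy = go k refl
      where
      go : ∀ j → k ≡ j → Selects K (v ∷ v′ ∷ x ∷ y ∷ z ∷ vs)
      -- Here e = 4 + j: the vectors `v`, `v′`, `x` are completed by j + 1 vectors summing to `w`.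
      go (suc j) refl with extend-det v {y} {z ∷ vs} j uvy (ℕ.m≤n⇒m≤1+n (ℕ.≤-trans (ℕ.n≤1+n j) k≤))
      -- `avoid₁` must start from a unit, which `det v′ x` is and `det w x` need not be. So `v′`
      -- keeps weight 1 and all of `w` is scaled by `u`.
      ... | w , c , uvw with avoid₁ uv′x (det w x)
      ... | u , uu , uw′x = 0V
          , comb-↭ (prep v (swap x v′ refl)) (comb-cramer uvx uw″x uvw″ (take 1ℤ unit-1 (comb-• uu c)))
          , mem-0 K
        where
        w″ : V
        w″ = 1ℤ • v′ ⊹ u • w
        lem₁ : ∀ v₁ v₂ w₁ w₂ x₁ x₂ u →
          (v₁ * x₂ - v₂ * x₁) + u * (w₁ * x₂ - w₂ * x₁) ≡
          (1ℤ * v₁ + u * w₁) * x₂ - (1ℤ * v₂ + u * w₂) * x₁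
        lem₁ = solve-∀
        lem₂ : ∀ v₁ v₂ w₁ w₂ x₁ x₂ u →
          u * (x₁ * w₂ - x₂ * w₁) + (x₁ * v₂ - x₂ * v₁) ≡
          x₁ * (1ℤ * v₂ + u * w₂) - x₂ * (1ℤ * v₁ + u * w₁)
        lem₂ = solve-∀
        uw″x : Unit (det w″ x)
        uw″x = subst Unit (lem₁ (proj₁ v′) (proj₂ v′) (proj₁ w) (proj₂ w) (proj₁ x) (proj₂ x) u) uw′x
        uvw″ : Unit (det v w″)
        uvw″ = subst Unit (lem₂ (proj₁ v′) (proj₂ v′) (proj₁ w) (proj₂ w) (proj₁ v) (proj₂ v) u)
          (unit-+zero (unit-* uu uvw) zvv′)
      go zero refl with small refl
      -- For e = 3, either one of the triples v, x, y and v, x, z is pairwise independent, or one of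
      -- v, v′, z and x, y, z lies on a line.
      ... | refl , refl with zero? (det x y) | zero? (det v z) | zero? (det x z)
      ... | no uxy | _ | _ =
            0V , comb-↭ (↭-trans (prep v (prep x (swap y v′ refl))) (prep v (swap x v′ refl)))
              (circuit uvx uvy uxy)
          , mem-0 K
      ... | yes _ | no uvz | no uxz =
            0V
          , comb-↭ (prep v (↭-trans (prep x (↭-trans (swap z v′ refl) (prep v′ (swap z y refl)))) (swap x v′ refl)))
              (circuit uvx uvz uxz)
          , mem-0 K
      ... | yes _ | yes zvz | _ =
            selects-↭ {K = K} (prep v (prep v′ (↭-trans (prep x (swap y z refl)) (swap x z refl))))
              (collinear K x zvv′ zvz uvx uv′x)
      ... | yes zxy | no _ | yes zxz = selects-∷ {K = K} (selects-∷ {K = K}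
              (collinear K v zxy zxz (unit-det-sym v x uvx) (unit-det-sym v y uvy)))

    -- Cramer's rule for the pair `x`, `y`, where the third vector is a sum of `z` and k = e - 3
    -- others. `step` chooses the weights so that both determinants remain units.
    triangle : ∀ {a b} (K : Lattice a b) {Q : Pred V 0ℓ} {x y z} →
      (∀ {w} v → Unit (det w y) × Unit (det x w) → Q v →
        ∃[ u ] Unit u × Unit (det w y + u * det v y) × Unit (det x w + u * det x v)) →
      Unit (det x y) → Unit (det x z) → Unit (det y z) →
      ∀ {vs} → All Q vs → k ℕ.≤ length vs → Selects K (x ∷ y ∷ z ∷ vs)
    triangle K {Q} {x} {y} {z} step uxy uxz uyz {vs} Qs k≤
      with extend {P = λ w → Unit (det w y) × Unit (det x w)} {Q = Q} step′ k (unit-det-sym y z uyz , uxz) Qs k≤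
      where
      step′ : ∀ {w} v → Unit (det w y) × Unit (det x w) → Q v →
        ∃[ u ] Unit u × Unit (det (u • v ⊹ w) y) × Unit (det x (u • v ⊹ w))
      step′ {w} v us Qv with step v us Qv
      ... | u , uu , u₁ , u₂ = u , uu
          , subst Unit (sym (det-linearˡ u v w y)) u₁ , subst Unit (sym (det-linearʳ u v w x)) u₂
    ... | w , c , uwy , uxw = 0V , comb-cramer uxy uwy uxw c , mem-0 K

    -- As `x` and `y` are independent, the vectors of `vs` vanish mod p and adding them does not
    -- change the determinants mod p.
    triangle-flat : ∀ {a b} (K : Lattice a b) {x y z} →
      Unit (det x y) → Unit (det x z) → Unit (det y z) →
      ∀ {vs} → All (λ v → Zero (det x v) × Zero (det y v)) vs → k ℕ.≤ length vs →
      Selects K (x ∷ y ∷ z ∷ vs)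
    triangle-flat K {x} {y} = triangle K λ { v (u₁ , u₂) (z₁ , z₂) → 1ℤ , unit-1
      , unit-+zero u₁ (∣n⇒∣m*n 1ℤ (zero-det-sym y v z₂))
      , unit-+zero u₂ (∣n⇒∣m*n 1ℤ z₁) }

    both-zero : ∀ x y {v} → ¬ Unit (det x v) × ¬ (Zero (det x v) × Unit (det y v)) →
      Zero (det x v) × Zero (det y v)
    both-zero x y (¬u , ¬zu) = ¬unit⇒zero ¬u , ¬unit⇒zero (λ u → ¬zu (¬unit⇒zero ¬u , u))

    -- For p = 3 the greedy choice of weights can fail. There each vector of vs is zero
    -- mod p, parallel to one of x, y, z, or of the fourth direction; two of the last
    -- kind are parallel, and a single one is left out.
    pairwise-independent : ∀ {a b} (K : Lattice (suc a) (suc b)) → (k ≡ 0 → a ≡ 0 × b ≡ 0) →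
      ∀ {x y z vs} → Unit (det x y) → Unit (det x z) → Unit (det y z) →
      2 ℕ.+ k ℕ.≤ length vs → Selects K (x ∷ y ∷ z ∷ vs)
    pairwise-independent K small {x} {y} {z} {vs} uxy uxz uyz len with p ℕ.≟ 3
    ... | no p≢3 = triangle K {Q = λ _ → ⊤}
            (λ { {w} v (u₁ , u₂) _ → avoid₂ (unit-3 p≢3) u₁ u₂ (det v y) (det x v) })
            uxy uxz uyz (All.universal (λ _ → tt) vs) (ℕ.≤-trans (ℕ.m≤n+m k 2) len)
    ... | yes p≡3
        -- The second condition in each search excludes vectors that vanish mod p; a vector found is
        -- parallel to `x`, `y` or `z` and forms a parallel pair with it.
        with pick (λ v → zero? (det x v) ×-dec unit? (det y v)) vs
           | pick (λ v → zero? (det y v) ×-dec unit? (det x v)) vs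
           | pick (λ v → zero? (det z v) ×-dec unit? (det x v)) vs
    ... | inj₁ (v , vs′ , π , zxv , uyv) | _ | _ = selects-↭ {K = K}
            (prep x (↭-trans (prep y (prep z π)) (↭-trans (prep y (swap z v refl)) (swap y v refl))))
            (parallel-pair K small (s≤s⁻¹ (ℕ.≤-trans len (ℕ.≤-reflexive (↭-length π))))
              zxv uxy (unit-det-sym y v uyv) uxz)
    ... | inj₂ _ | inj₁ (v , vs′ , π , zyv , uxv) | _ = selects-↭ {K = K}
            (↭-trans (swap x y (↭-trans (prep z π) (swap z v refl))) (prep y (swap x v refl)))
            (parallel-pair K small (s≤s⁻¹ (ℕ.≤-trans len (ℕ.≤-reflexive (↭-length π))))
              zyv (unit-det-sym x y uxy) (unit-det-sym x v uxv) uyz)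
    ... | inj₂ _ | inj₂ _ | inj₁ (v , vs′ , π , zzv , uxv) = selects-↭ {K = K}
            (↭-trans (prep x (↭-trans (swap y z π) (prep z (swap y v refl))))
              (↭-trans (swap x z refl) (prep z (swap x v refl))))
            (parallel-pair K small (s≤s⁻¹ (ℕ.≤-trans len (ℕ.≤-reflexive (↭-length π))))
              zzv (unit-det-sym x z uxz) (unit-det-sym x v uxv) (unit-det-sym y z uyz))
    -- Now a vector `v` of `vs` with `det x v` zero vanishes mod p, and any other has the fourth
    -- direction.
    ... | inj₂ ¬x | inj₂ ¬y | inj₂ ¬z with pick (unit? ∘ det x) vs
    ...   | inj₂ zs = triangle-flat K uxy uxz uyz (All.zipWith (both-zero x y) (zs , ¬x)) (ℕ.≤-trans (ℕ.m≤n+m k 2) len)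
    ...   | inj₁ (v , vs′ , π , uxv)
          with All-resp-↭ π ¬x | All-resp-↭ π ¬y | All-resp-↭ π ¬z
             | ℕ.≤-trans len (ℕ.≤-reflexive (↭-length π)) | pick (unit? ∘ det x) vs′
    ...     | _ ∷ ¬x′ | _ | _ | len′ | inj₂ zs = selects-↭ {K = K}
              (↭-trans (prep x (↭-trans (prep y (↭-trans (prep z π) (swap z v refl))) (swap y v refl))) (swap x v refl))
              (selects-∷ {K = K} (triangle-flat K uxy uxz uyz (All.zipWith (both-zero x y) (zs , ¬x′))
                (ℕ.≤-trans (ℕ.n≤1+n k) (s≤s⁻¹ len′))))
    ...     | _ | ¬yv ∷ ¬y′ | ¬zv ∷ ¬z′ | len′ | inj₁ (w , vs″ , ρ , uxw)
            with All-resp-↭ ρ ¬y′ | All-resp-↭ ρ ¬z′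
    ...       | ¬yw ∷ _ | ¬zw ∷ _ = selects-↭ {K = K} σ
                -- After removing `v` and `w` only k further vectors are sure to remain in `vs″`;
                -- `z` supplies the missing one.
                (parallel-pair K small {vs = z ∷ vs″}
                  (ℕ.≤-trans (s≤s⁻¹ len′) (ℕ.≤-reflexive (↭-length ρ)))
                  (five-directions p≡3 {x} {y} {z} {v} {w} uxy uxz uyz uxv uyv uzv uxw uyw uzw)
                  (unit-det-sym x v uxv) (unit-det-sym x w uxw) (unit-det-sym y v uyv))
              where
              uyv : Unit (det y v)
              uyv zz = ¬yv (zz , uxv)
              uzv : Unit (det z v)
              uzv zz = ¬zv (zz , uxv)
              uyw : Unit (det y w)
              uyw zz = ¬yw (zz , uxw)
              uzw : Unit (det z w)
              uzw zz = ¬zw (zz , uxw)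
              σ : x ∷ y ∷ z ∷ vs ↭ v ∷ w ∷ x ∷ y ∷ z ∷ vs″
              σ = ↭-trans (++⁺ˡ (x ∷ y ∷ z ∷ []) (↭-trans π (prep v ρ)))
                    (↭-trans (shift v (x ∷ y ∷ z ∷ []) (w ∷ vs″)) (prep v (shift w (x ∷ y ∷ z ∷ []) vs″)))

    -- Search in turn for `x` nonzero mod p, for `y` and `z` independent of `x`, and, if `y` and `z`
    -- are parallel, for `w` independent of `y`. A failed search means that all vectors but at most
    -- one lie on a line mod p. If all succeed, there is a parallel pair or a pairwise independent
    -- triple.
    claim-step : ∀ {a b} → Claim a (suc b) → Claim (suc a) b →
      (k ≡ 0 → a ≡ 0 × b ≡ 0) → Claim (suc a) (suc b)
    claim-step {a} {b} claim₁ claim₂ small K vs len = go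
      where
      drop : ∀ d → NonZeroMod d → ∀ {x ws} → vs ↭ x ∷ ws → All (Zero ∘ det d) ws → Selects K vs
      drop d d≢0 {x} {ws} π zs = selects-↭ {K = K} π (selects-∷ {K = K} (on-line claim₁ claim₂ K d d≢0 zs
        (s≤s⁻¹ (ℕ.≤-trans (ℕ.≤-reflexive (sym (ℕ.+-suc e (a ℕ.+ suc b))))
          (ℕ.≤-trans len (ℕ.≤-reflexive (↭-length π)))))))

      room : ∀ {ws} → vs ↭ ws → 5 ℕ.+ k ℕ.≤ length ws
      room π = ℕ.≤-trans (ℕ.≤-trans (ℕ.≤-reflexive (ℕ.+-comm 2 e))
        (ℕ.+-monoʳ-≤ e (s≤s (ℕ.≤-trans (s≤s z≤n) (ℕ.m≤n+m (suc b) a)))))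
        (ℕ.≤-trans len (ℕ.≤-reflexive (↭-length π)))

      zeros : ∀ {d ws} → All (¬_ ∘ Unit ∘ det d) ws → All (Zero ∘ det d) ws
      zeros = All.map ¬unit⇒zero

      zero-self : ∀ v → Zero (det v v)
      zero-self v = subst Zero (sym (det-self v)) zero-0

      go₃ : ∀ {x y z ws} → vs ↭ x ∷ y ∷ z ∷ ws → Unit (det x y) → Unit (det x z) → Selects K vs
      go₃ {x} {y} {z} {ws} π uxy uxz with zero? (det y z) | pick (unit? ∘ det y) ws
      ... | no uyz | _ = selects-↭ {K = K} π
            (pairwise-independent K small uxy uxz uyz (s≤s⁻¹ (s≤s⁻¹ (s≤s⁻¹ (room π)))))
      ... | yes zyz | inj₂ zs = drop y (unit-det⇒nonZero (unit-det-sym x y uxy)) π (zero-self y ∷ zyz ∷ zeros {y} zs)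
      ... | yes zyz | inj₁ (w , ws′ , ρ , uyw) = selects-↭ {K = K} σ
            (parallel-pair K small (s≤s⁻¹ (s≤s⁻¹ (s≤s⁻¹ (s≤s⁻¹ (room (↭-trans π (prep x (prep y (prep z ρ)))))))))
              zyz (unit-det-sym x y uxy) (unit-det-sym x z uxz) uyw)
            where
            σ : vs ↭ y ∷ z ∷ x ∷ w ∷ ws′
            σ = ↭-trans π (↭-trans (prep x (prep y (prep z ρ))) (↭-sym (shift x (y ∷ z ∷ []) (w ∷ ws′))))

      go₂ : ∀ {x y ws} → vs ↭ x ∷ y ∷ ws → Unit (det x y) → Selects K vs
      go₂ {x} {y} {ws} π uxy with pick (unit? ∘ det x) ws
      ... | inj₂ zs = drop x (unit-det⇒nonZero uxy) (↭-trans π (swap x y refl)) (zero-self x ∷ zeros {x} zs)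
      ... | inj₁ (z , _ , ρ , uxz) = go₃ (↭-trans π (prep x (prep y ρ))) uxy uxz

      nonZero? : Decidable NonZeroMod
      nonZero? v = ¬? (zero? (proj₁ v) ×-dec zero? (proj₂ v))

      go : Selects K vs
      go with pick nonZero? vs
      go | inj₁ (x , ws , π , x≢0) with pick (unit? ∘ det x) ws
      ... | inj₂ zs = drop x x≢0 π (zeros {x} zs)
      ... | inj₁ (y , _ , ρ , uxy) = go₂ (↭-trans π (prep x ρ)) uxy
      go | inj₂ zs = on-line claim₁ claim₂ K e₁ (λ { (z , _) → unit-1 z })
            (All.map (λ {v} ¬¬z → flat v (decidable-stable (zero? (proj₁ v) ×-dec zero? (proj₂ v)) ¬¬z)) zs)
            (ℕ.≤-trans (ℕ.+-monoʳ-≤ e (ℕ.n≤1+n _)) len)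
        where
        flat : ∀ v → Zero (proj₁ v) × Zero (proj₂ v) → Zero (det e₁ v)
        flat v (z₁ , z₂) = ∣m∣n⇒∣m-n (∣n⇒∣m*n 1ℤ z₂) (∣n⇒∣m*n 0ℤ z₁)

    -- The condition passes to smaller a and b, and for e = 3 it ensures that `parallel-pair` is
    -- only needed for `Lattice 1 1`.
    claim : ∀ a b → (k ≡ 0 → a ℕ.≤ 1 × b ℕ.≤ 1) → Claim a b
    claim a zero _ = claim-rank₁ a
    claim zero (suc b) _ K vs len =
      descend (claim-rank₁ (suc b)) K e₂ e₁ (mem₂ K) (mem₁ K) (All.universal span-swap vs)
        (subst (λ n → e ℕ.+ n ℕ.≤ length vs) (sym (ℕ.+-identityʳ (suc b))) len)
    claim (suc a) (suc b) small = claim-step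
      (claim a (suc b) λ k≡0 → ℕ.≤-trans (ℕ.n≤1+n a) (proj₁ (small k≡0)) , proj₂ (small k≡0))
      (claim (suc a) b λ k≡0 → proj₁ (small k≡0) , ℕ.≤-trans (ℕ.n≤1+n b) (proj₂ (small k≡0)))
      λ k≡0 → ℕ.n≤0⇒n≡0 (s≤s⁻¹ (proj₁ (small k≡0))) , ℕ.n≤0⇒n≡0 (s≤s⁻¹ (proj₂ (small k≡0)))

  3≤p : 3 ℕ.≤ p
  3≤p = ℕ.≤∧≢⇒< (ℕ.nonTrivial⇒n>1 p {{prime⇒nonTrivial p-prime}}) λ { refl → p-odd ℕ.∣-refl }

  -- Sequences without weighted zero-sums

  tower : V → ℕ → List V
  tower g zero    = []
  tower g (suc n) = g ∷ tower (+ p • g) n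

  length-tower : ∀ g n → length (tower g n) ≡ n
  length-tower g zero    = refl
  length-tower g (suc n) = cong suc (length-tower (+ p • g) n)

  -- If pⁱ g is the first entry taken from the tower, the later ones are multiples of pⁱ⁺¹ g, so
  -- pⁱ⁺¹ does not divide `t`, and i < n. The tail `vs` makes it possible to stack two towers.
  comb-tower : ∀ g n {vs m w} → Comb (tower g n ++ vs) m w →
    ∃[ m₁ ] ∃[ m₂ ] ∃[ t ] ∃[ w′ ] m ≡ m₁ ℕ.+ m₂ × Comb vs m₂ w′ × w ≡ t • g ⊹ w′ ×
      (+ (p ℕ.^ n) ∣ t → m₁ ≡ 0)
  comb-tower g zero {m = m} {w} c = 0 , m , 0ℤ , w , refl , c
    , V-≡ (sym (ℤ.+-identityˡ _)) (sym (ℤ.+-identityˡ _)) , λ _ → refl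
  comb-tower g (suc n) (skip c) with comb-tower (+ p • g) n c
  ... | m₁ , m₂ , t , w′ , m≡ , c′ , w≡ , free = m₁ , m₂ , t * + p , w′ , m≡ , c′
      , ≡-trans w≡ (cong (_⊹ w′) (V-≡ (sym (ℤ.*-assoc t (+ p) _)) (sym (ℤ.*-assoc t (+ p) _))))
      , λ p^∣ → free (*-cancelʳ-∣ (+ p) (subst (_∣ t * + p) (eq (p ℕ.^ n)) p^∣))
      where
      eq : ∀ q → + (p ℕ.* q) ≡ + q * + p
      eq q = ≡-trans (cong +_ (ℕ.*-comm p q)) (ℤ.pos-* q p)
  comb-tower g (suc n) (take u uu c) with comb-tower (+ p • g) n c
  ... | m₁ , m₂ , t , w′ , m≡ , c′ , refl , _ = suc m₁ , m₂ , u + t * + p , w′ , cong suc m≡ , c′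
      , V-≡ (lem u t (+ p) (proj₁ g) (proj₁ w′)) (lem u t (+ p) (proj₂ g) (proj₂ w′))
      , λ p^∣ → ⊥-elim (uu (∣m+n∣n⇒∣m (∣-trans p∣p^ p^∣) (∣n⇒∣m*n t ∣-refl)))
      where
      p∣p^ : + p ∣ + (p ℕ.^ suc n)
      p∣p^ = ∣ᵤ⇒∣ (ℕ.m∣m*n (p ℕ.^ n))
      lem : ∀ u t p g w → u * g + (t * (p * g) + w) ≡ (u + t * p) * g + w
      lem = solve-∀

  -- Omitting the zeros that were taken preserves the sum. This serves the upper bound for η and the
  -- lower bound for s.
  comb-zeros : ∀ z {vs m w} → Comb (replicate z 0V ++ vs) m w →
    ∃[ m₁ ] ∃[ m₂ ] m ≡ m₁ ℕ.+ m₂ × m₁ ℕ.≤ z × Comb vs m₂ w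
  comb-zeros zero c = 0 , _ , refl , z≤n , c
  comb-zeros (suc z) (skip c) with comb-zeros z c
  ... | m₁ , m₂ , m≡ , m₁≤ , c′ = m₁ , m₂ , m≡ , ℕ.m≤n⇒m≤1+n m₁≤ , c′
  comb-zeros (suc z) (take {w = w} u _ c) with comb-zeros z c
  ... | m₁ , m₂ , m≡ , m₁≤ , c′ = suc m₁ , m₂ , cong suc m≡ , s≤s m₁≤
      , comb-≡ (V-≡ (lem u (proj₁ w)) (lem u (proj₂ w))) c′
    where
    lem : ∀ u x → x ≡ u * 0ℤ + x
    lem = solve-∀

  extremal : ℕ → ℕ → List V
  extremal α β = tower e₁ α ++ (tower e₂ β ++ [])

  length-extremal : ∀ α β → length (extremal α β) ≡ α ℕ.+ β
  length-extremal α β = begin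
    length (extremal α β)
      ≡⟨ length-++ (tower e₁ α) ⟩
    length (tower e₁ α) ℕ.+ length (tower e₂ β ++ [])
      ≡⟨ cong₂ ℕ._+_ (length-tower e₁ α) (length-++ (tower e₂ β)) ⟩
    α ℕ.+ (length (tower e₂ β) ℕ.+ 0)
      ≡⟨ cong (α ℕ.+_) (≡-trans (ℕ.+-identityʳ _) (length-tower e₂ β)) ⟩
    α ℕ.+ β ∎
    where open ≡-Reasoning

  extremal-free : ∀ α β {m w} → Comb (extremal α β) m w →
    + (p ℕ.^ α) ∣ proj₁ w → + (p ℕ.^ β) ∣ proj₂ w → m ≡ 0
  extremal-free α β c d₁ d₂ with comb-tower e₁ α c
  ... | m₁ , m₂ , t , w′ , refl , c′ , refl , free₁ with comb-tower e₂ β c′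
  ... | n₁ , _ , t′ , _ , refl , [] , refl , free₂
    = cong₂ ℕ._+_ (free₁ (subst (_ ∣_) (lem₁ t t′) d₁)) (cong (ℕ._+ 0) (free₂ (subst (_ ∣_) (lem₂ t t′) d₂)))
      where
      lem₁ : ∀ t t′ → t * 1ℤ + (t′ * 0ℤ + 0ℤ) ≡ t
      lem₁ = solve-∀
      lem₂ : ∀ t t′ → t * 0ℤ + (t′ * 1ℤ + 0ℤ) ≡ t′
      lem₂ = solve-∀

  -- The group, its exponent and the two invariants.

  module Group (α β : ℕ) (1≤α : 1 ℕ.≤ α) where

    G = ℤmod (p ℕ.^ α) ⊕ ℤmod (p ℕ.^ β)

    E : ℕ
    E = p ℕ.^ (α ℕ.⊔ β)

    instance
      E-nonZero : ℕ.NonZero E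
      E-nonZero = ℕ.m^n≢0 p (α ℕ.⊔ β)

    weightedSum : List ℤ → List V → V
    weightedSum us vs = foldr _⊹_ 0V (zipWith (_·_ G) us vs)

    ·-• : ∀ n v → _·_ G (+ n) v ≡ + n • v
    ·-• zero    v = refl
    ·-• (suc n) v = ≡-trans (cong (v ⊹_) (·-• n v)) (V-≡ (lem (+ n) (proj₁ v)) (lem (+ n) (proj₂ v)))
      where
      lem : ∀ n x → x + n * x ≡ (1ℤ + n) * x
      lem = solve-∀

    Trivial : V → Set
    Trivial w = (+ (p ℕ.^ α) ∣ proj₁ w) × (+ (p ℕ.^ β) ∣ proj₂ w)

    p^α∣E : + (p ℕ.^ α) ∣ + E
    p^α∣E = ∣ᵤ⇒∣ (^-mono-∣ (ℕ.m≤m⊔n α β))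

    p^β∣E : + (p ℕ.^ β) ∣ + E
    p^β∣E = ∣ᵤ⇒∣ (^-mono-∣ (ℕ.m≤n⊔m α β))

    p∣E : + p ∣ + E
    p∣E = ∣ᵤ⇒∣ (ℕ.∣-trans (ℕ.∣-reflexive (sym (ℕ.^-identityʳ p))) (^-mono-∣ (ℕ.≤-trans 1≤α (ℕ.m≤m⊔n α β))))

    weight⇒unit : ∀ {k} → gcd k p ≡ 1 → Unit (+ k)
    weight⇒unit {k} gcd≡1 z = p∤1 (subst (p ℕ.∣_) gcd≡1 (gcd-greatest (∣⇒∣ᵤ z) ℕ.∣-refl))

    unit⇒coprime : ∀ {k} → Unit (+ k) → gcd k p ≡ 1
    unit⇒coprime {k} u with prime⇒irreducible p-prime (gcd[m,n]∣n k p)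
    ... | inj₁ gcd≡1 = gcd≡1
    ... | inj₂ gcd≡p = contradiction (∣ᵤ⇒∣ (subst (ℕ._∣ k) gcd≡p (gcd[m,n]∣m k p))) u

    -- Because p divides E, the remainder of a unit mod E is again a unit; in particular it is not
    -- 0.
    unit⇒weight : ∀ u → Unit u → coprimeWeights p E (+ (u ℤ.%ℕ E))
    unit⇒weight u uu = u ℤ.%ℕ E , refl , 1≤r , ℕ.<⇒≤ (ℤ.n%ℕd<d u E) , unit⇒coprime ur
      where
      ur : Unit (+ (u ℤ.%ℕ E))
      ur z = uu (subst Zero (sym (ℤ.a≡a%ℕn+[a/ℕn]*n u E)) (∣m∣n⇒∣m+n z (∣n⇒∣m*n (u ℤ./ℕ E) p∣E)))
      1≤r : 1 ℕ.≤ u ℤ.%ℕ E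
      1≤r = ℕ.n≢0⇒n>0 λ r≡0 → ur (subst (Zero ∘ +_) (sym r≡0) zero-0)

    sublist⇒comb : ∀ {ys xs} us → ys ⊆ xs → length us ≡ length ys → All (coprimeWeights p E) us →
      Comb xs (length ys) (weightedSum us ys)
    sublist⇒comb [] [] _ _ = []
    sublist⇒comb us (_ ∷ʳ σ) len As = skip (sublist⇒comb us σ len As)
    sublist⇒comb (_ ∷ us) (_∷_ {x = v} refl σ) len ((k , refl , _ , _ , gcd≡1) ∷ As) =
      comb-≡ (cong (_⊹ _) (sym (·-• k v)))
        (take (+ k) (weight⇒unit gcd≡1) (sublist⇒comb us σ (ℕ.suc-injective len) As))

    comb⇒sublist : ∀ {xs n w} → Comb xs n w →
      ∃[ ys ] ys ⊆ xs × length ys ≡ n × ∃[ us ] length us ≡ length ys × All (coprimeWeights p E) us ×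
        (Trivial w → Trivial (weightedSum us ys))
    comb⇒sublist c with go c
      where
      -- Reducing the weights mod E changes the sum by a multiple of E, which vanishes in G.
      go : ∀ {xs n w} → Comb xs n w →
        ∃[ ys ] ys ⊆ xs × length ys ≡ n × ∃[ us ] length us ≡ length ys × All (coprimeWeights p E) us ×
          ∃[ t ] weightedSum us ys ≡ w ⊹ + E • t
      go [] = [] , [] , refl , [] , refl , [] , 0V , V-≡ (sym (lem (+ E))) (sym (lem (+ E)))
        where
        lem : ∀ e → 0ℤ + e * 0ℤ ≡ 0ℤ
        lem = solve-∀
      go (skip c) with go c
      ... | ys , σ , len , rest = ys , _ ∷ʳ σ , len , rest
      go (take {v} {w = w} u uu c) with go c
      ... | ys , σ , len , us , len′ , As , t , eq =
            v ∷ ys , refl ∷ σ , cong suc len , + (u ℤ.%ℕ E) ∷ us , cong suc len′ , unit⇒weight u uu ∷ As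
          , t ⊹ (- q) • v , ≡-trans (cong₂ _⊹_ (·-• (u ℤ.%ℕ E) v) eq)
              (V-≡ (step (proj₁ v) (proj₁ w) (proj₁ t)) (step (proj₂ v) (proj₂ w) (proj₂ t)))
          where
          q r : ℤ
          q = u ℤ./ℕ E
          r = + (u ℤ.%ℕ E)
          lem : ∀ r q e v w t → r * v + (w + e * t) ≡ ((r + q * e) * v + w) + e * (t + - q * v)
          lem = solve-∀
          step : ∀ v w t → r * v + (w + + E * t) ≡ (u * v + w) + + E * (t + - q * v)
          step v w t = ≡-trans (lem r q (+ E) v w t)
            (cong (λ u → (u * v + w) + + E * (t + - q * v)) (sym (ℤ.a≡a%ℕn+[a/ℕn]*n u E)))
    ... | ys , σ , len , us , len′ , As , t , eq = ys , σ , len , us , len′ , As , λ { (z₁ , z₂) →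
          subst Trivial (sym eq) ( ∣m∣n⇒∣m+n z₁ (∣m⇒∣m*n (proj₁ t) p^α∣E)
                                 , ∣m∣n⇒∣m+n z₂ (∣m⇒∣m*n (proj₂ t) p^β∣E)) }

    kernel : Lattice α β
    kernel = record
      { Mem   = Trivial
      ; add   = λ { (a , b) (c , d) → ∣m∣n⇒∣m+n a c , ∣m∣n⇒∣m+n b d }
      ; scale = λ { c (a , b) → ∣n⇒∣m*n c a , ∣n⇒∣m*n c b }
      ; mem₁  = ∣m⇒∣m*n 1ℤ ∣-refl , ∣n⇒∣m*n (+ (p ℕ.^ α)) (divides 0ℤ refl)
      ; mem₂  = ∣n⇒∣m*n (+ (p ℕ.^ β)) (divides 0ℤ refl) , ∣m⇒∣m*n 1ℤ ∣-refl
      }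

    open AbelianGroup G using (_≈_; ε)

    trivial⇒≈ : ∀ {w} → Trivial w → w ≈ ε
    trivial⇒≈ (a , b) = subst (_ ∣_) (sym (ℤ.+-identityʳ _)) a , subst (_ ∣_) (sym (ℤ.+-identityʳ _)) b

    ≈⇒trivial : ∀ {w} → w ≈ ε → Trivial w
    ≈⇒trivial (a , b) = subst (_ ∣_) (ℤ.+-identityʳ _) a , subst (_ ∣_) (ℤ.+-identityʳ _) b

    zeroSum : ∀ {xs n w} → 1 ℕ.≤ n → Comb xs n w → Trivial w →
      ∃[ ys ] ys ⊆ xs × length ys ≡ n × IsWeightedZeroSum G (coprimeWeights p E) ys
    zeroSum 1≤n c z with comb⇒sublist c
    ... | ys , σ , refl , us , len , As , triv = ys , σ , refl , 1≤n , us , len , As , trivial⇒≈ (triv z)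

    isExponent : IsExponent G E
    isExponent = (ℕ.n≢0⇒n>0 (ℕ.≢-nonZero⁻¹ E) , λ x → trivial⇒≈ (subst Trivial (sym (·-• E x))
        (∣m⇒∣m*n (proj₁ x) p^α∣E , ∣m⇒∣m*n (proj₂ x) p^β∣E))) , minimal
      where
      minimal : ∀ k → 1 ℕ.≤ k × (∀ x → _·_ G (+ k) x ≈ ε) → E ℕ.≤ k
      -- The element (1, 1) has order E.
      minimal k@(suc _) (_ , kills) with subst Trivial (·-• k (1ℤ , 1ℤ)) (≈⇒trivial (kills (1ℤ , 1ℤ)))
      ... | d₁ , d₂ with ℕ.⊔-sel α β
      ... | inj₁ eq = ℕ.∣⇒≤ (subst (λ m → p ℕ.^ m ℕ.∣ k) (sym eq) (∣⇒∣ᵤ (subst (+ (p ℕ.^ α) ∣_) (ℤ.*-identityʳ (+ k)) d₁)))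
      ... | inj₂ eq = ℕ.∣⇒≤ (subst (λ m → p ℕ.^ m ℕ.∣ k) (sym eq) (∣⇒∣ᵤ (subst (+ (p ℕ.^ β) ∣_) (ℤ.*-identityʳ (+ k)) d₂)))

    3≤E : 3 ℕ.≤ E
    3≤E = ℕ.≤-trans 3≤p (ℕ.∣⇒≤ (∣⇒∣ᵤ p∣E))

    -- As p ≥ 3, an exponent of at least 2 would give E ≥ 9.
    E≡3⇒elementary : E ≡ 3 → α ℕ.≤ 1 × β ℕ.≤ 1
    E≡3⇒elementary E≡3 = ℕ.≤-trans (ℕ.m≤m⊔n α β) m≤1 , ℕ.≤-trans (ℕ.m≤n⊔m α β) m≤1
      where
      m≤1 : α ℕ.⊔ β ℕ.≤ 1
      m≤1 = ℕ.≮⇒≥ λ 2≤m → ℕ.<⇒≱ {3} {9} (s≤s (s≤s (s≤s (s≤s z≤n))))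
        (ℕ.≤-trans (ℕ.*-mono-≤ 3≤p (ℕ.*-mono-≤ 3≤p (ℕ.≤-refl {1})))
          (ℕ.≤-trans (ℕ.^-monoʳ-≤ p 2≤m) (ℕ.≤-reflexive E≡3)))

    comb-exists : ∀ xs → E ℕ.+ (α ℕ.+ β) ℕ.≤ length xs → ∃[ w ] Comb xs E w × Trivial w
    comb-exists xs len = subst (λ n → ∃[ w ] Comb xs n w × Trivial w) E≡
      (claim α β (λ k≡0 → E≡3⇒elementary (≡-trans (sym E≡) (cong (3 ℕ.+_) k≡0))) kernel xs
        (subst (λ n → n ℕ.+ (α ℕ.+ β) ℕ.≤ length xs) (sym E≡) len))
      where
      open Selection (E ℕ.∸ 3)
      E≡ : 3 ℕ.+ (E ℕ.∸ 3) ≡ E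
      E≡ = ℕ.m+[n∸m]≡n 3≤E

    is-s : Is-s G (coprimeWeights p E) (α ℕ.+ β ℕ.+ E)
    is-s = E , isExponent , upper , lower
      where
      upper : ∀ xs → α ℕ.+ β ℕ.+ E ℕ.≤ length xs → _
      upper xs len with comb-exists xs (ℕ.≤-trans (ℕ.≤-reflexive (ℕ.+-comm E (α ℕ.+ β))) len)
      ... | w , c , z = zeroSum (ℕ.≤-trans (s≤s z≤n) 3≤E) c z
      witness : List V
      witness = replicate (ℕ.pred E) 0V ++ extremal α β
      length-witness : length witness ≡ ℕ.pred E ℕ.+ (α ℕ.+ β)
      length-witness = ≡-trans (length-++ (replicate (ℕ.pred E) 0V))
        (cong₂ ℕ._+_ (length-replicate (ℕ.pred E)) (length-extremal α β))
      lower : ∀ k → _ → α ℕ.+ β ℕ.+ E ℕ.≤ k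
      lower k all = ℕ.≮⇒≥ λ k< → absurd (all witness
        (ℕ.≤-trans (s≤s⁻¹ (ℕ.≤-trans k< (ℕ.≤-reflexive eq))) (ℕ.≤-reflexive (sym length-witness))))
        where
        eq : α ℕ.+ β ℕ.+ E ≡ suc (ℕ.pred E ℕ.+ (α ℕ.+ β))
        eq = ≡-trans (ℕ.+-comm (α ℕ.+ β) E) (cong (ℕ._+ (α ℕ.+ β)) (sym (ℕ.suc-pred E)))
        absurd : ∃[ ys ] ys ⊆ witness × length ys ≡ E × IsWeightedZeroSum G (coprimeWeights p E) ys → ⊥
        absurd (ys , σ , len , _ , us , len′ , As , z)
          with comb-zeros (ℕ.pred E) (sublist⇒comb us σ len′ As) | ≈⇒trivial z
        -- Nothing can come from the extremal sequence, so all E terms would have to be among E - 1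
        -- zeros.
        ... | m₁ , m₂ , m≡ , m₁≤ , c | d₁ , d₂ rewrite extremal-free α β c d₁ d₂ =
              ℕ.<⇒≱ (ℕ.≤-reflexive (ℕ.suc-pred E))
                (ℕ.≤-trans (ℕ.≤-reflexive (≡-trans (sym len) (≡-trans m≡ (ℕ.+-identityʳ m₁)))) m₁≤)

    is-η : Is-η G (coprimeWeights p E) (suc (α ℕ.+ β))
    is-η = E , isExponent , upper , lower
      where
      upper : ∀ xs → suc (α ℕ.+ β) ℕ.≤ length xs →
        ∃[ ys ] ys ⊆ xs × length ys ℕ.≤ E × IsWeightedZeroSum G (coprimeWeights p E) ys
      upper xs len with comb-exists (replicate (ℕ.pred E) 0V ++ xs) (begin
          E ℕ.+ (α ℕ.+ β)                     ≡⟨ cong (ℕ._+ (α ℕ.+ β)) (sym (ℕ.suc-pred E)) ⟩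
          suc (ℕ.pred E) ℕ.+ (α ℕ.+ β)        ≡⟨ sym (ℕ.+-suc (ℕ.pred E) (α ℕ.+ β)) ⟩
          ℕ.pred E ℕ.+ suc (α ℕ.+ β)          ≤⟨ ℕ.+-monoʳ-≤ (ℕ.pred E) len ⟩
          ℕ.pred E ℕ.+ length xs              ≡⟨ cong (ℕ._+ length xs) (sym (length-replicate (ℕ.pred E))) ⟩
          length (replicate (ℕ.pred E) 0V) ℕ.+ length xs ≡⟨ sym (length-++ (replicate (ℕ.pred E) 0V)) ⟩
          length (replicate (ℕ.pred E) 0V ++ xs) ∎)
        where open ℕ.≤-Reasoning
      ... | w , c , z with comb-zeros (ℕ.pred E) c
      ... | m₁ , m₂ , E≡ , m₁≤ , c′ with zeroSum 1≤m₂ c′ z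
        where
        -- Only E - 1 zeros were appended, so at least one of the E terms comes from `xs`.
        1≤m₂ : 1 ℕ.≤ m₂
        1≤m₂ = ℕ.n≢0⇒n>0 λ { refl → ℕ.<⇒≱ (ℕ.≤-reflexive (ℕ.suc-pred E))
          (ℕ.≤-trans (ℕ.≤-reflexive (≡-trans E≡ (ℕ.+-identityʳ m₁))) m₁≤) }
      ... | ys , σ , len′ , zs = ys , σ
          , ℕ.≤-trans (ℕ.≤-reflexive len′) (ℕ.≤-trans (ℕ.m≤n+m m₂ m₁) (ℕ.≤-reflexive (sym E≡)))
          , zs
      lower : ∀ k → _ → suc (α ℕ.+ β) ℕ.≤ k
      lower k all = ℕ.≮⇒≥ λ k< → absurd (all (extremal α β)
        (ℕ.≤-trans (s≤s⁻¹ k<) (ℕ.≤-reflexive (sym (length-extremal α β)))))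
        where
        absurd : ∃[ ys ] ys ⊆ extremal α β × length ys ℕ.≤ E × IsWeightedZeroSum G (coprimeWeights p E) ys → ⊥
        absurd (ys , σ , _ , 1≤ , us , len , As , z) with ≈⇒trivial z
        ... | d₁ , d₂ = ℕ.<⇒≱ 1≤ (ℕ.≤-reflexive (extremal-free α β (sublist⇒comb us σ len As) d₁ d₂))

open import Data.Nat.Base using (_+_; _∸_; _^_; _⊔_; _≤_)
open import Data.Nat.Divisibility using (_∣_)

corollary6p2 :
  (p : ℕ) → Prime p → ¬ (2 ∣ p) →
  (α β : ℕ) → 1 ≤ α → 1 ≤ β →
  let G = ℤmod (p ^ α) ⊕ ℤmod (p ^ β)
      e = p ^ (α ⊔ β)
      A = coprimeWeights p e
  in IsExponent G e ×
     (∃[ s ] ∃[ η ] Is-s G A s × Is-η G A η × s ≡ η + e ∸ 1)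
corollary6p2 p p-prime p-odd α β 1≤α _ =
  -- `suc (α + β) + e ∸ 1` computes to `α + β + e`, whence the final `refl`.
  isExponent , α + β + p ^ (α ⊔ β) , suc (α + β) , is-s , is-η , refl
  where open Weights.Group p p-prime p-odd α β 1≤α
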